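{- Let $G$ be a graph. Then the completely join-irreducible elements of $\mathsf{R}(G)$ are exactly the sets $\varphi(\mathtt{j}(\mu))$, where $H$ ranges over nonempty connected subsets of $G$ and $\mu$ ranges over pseudo-ultrafilters on $H$.
   Context: For a graph $G$, $\mathcal{C}(G)$ is the set of nonempty connected subsets of $G$. For $\boldsymbol{x}\subseteq\mathcal{C}(G)$, $\varphi(\boldsymbol{x})$ is the set of $X\in\mathcal{C}(G)$ that are the disjoint union of some nonempty finite subset of $\boldsymbol{x}$; $\check\varphi(\boldsymbol{x})=\mathcal{C}(G)\setminus\varphi(\mathcal{C}(G)\setminus\boldsymbol{x})$; $\mathsf{R}(G)$ is the lattice of regular closed subsets ($\boldsymbol{x}=\varphi\check\varphi(\boldsymbol{x})$) of $\mathcal{C}(G)$ under inclusion. An element $a$ of a lattice is completely join-irreducible if it has a unique lower cover $a_*$ and every $y<a$ satisfies $y\le a_*$. For $H\in\mathcal{C}(G)$, $\mathrm{Cuts}(H)$ is the set of nonempty $X\subseteq H$ such that $X$ and $H\setminus X$ are both connected (the empty set counts as connected, so $H\in\mathrm{Cuts}(H)$). A pseudo-ultrafilter on $H$ is a set $\mu\subseteq\mathrm{Cuts}(H)$ with $H\in\mu$ such that for all cuts $X,Y,Z$ of $H$ with $Z=X\cup Y$ and $X\cap Y=\varnothing$: (i) $X,Y\in\mu$ implies $Z\in\mu$; (ii) $X,Y\notin\mu$ implies $Z\notin\mu$; (iii) for every cut $X\neq H$, $X\in\mu$ iff $H\setminus X\notin\mu$. For such $\mu$, $\mathtt{j}(\mu)$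 is the set of nonempty connected subsets $X\subseteq H$ such that $H\setminus X$ has only finitely many connected components and none of these components belongs to $\mu$. -}

module Defs where

open import Level using (Level; 0ℓ; Lift) renaming (suc to lsuc)
open import Data.Empty using (⊥)
open import Data.Product using (Σ; ∃; _×_; _,_)
open import Data.Sum using (_⊎_)
open import Data.List using (List; []; _∷_)
open import Data.List.Relation.Unary.All using (All)
open import Data.List.Relation.Unary.Any using (Any)
open import Data.List.Relation.Unary.AllPairs using (AllPairs)
open import Relation.Nullary using (¬_)

record Graph : Set₁ where
  field
    V     : Set
    E     : V → V → Set
    E-sym : ∀ {x y} → E x y → E y x
    E-irr : ∀ {x} → ¬ E x x

module _ (G : Graph) where
  open Graph G

  Sub : Set₁
  Sub = V → Set

  Fam : Set₂
  Fam = Sub → Set₁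

  _⊆_ : Sub → Sub → Set
  X ⊆ Y = ∀ {v} → X v → Y v

  _≐_ : Sub → Sub → Set
  X ≐ Y = (X ⊆ Y) × (Y ⊆ X)

  _∖_ : Sub → Sub → Sub
  (X ∖ Y) v = X v × ¬ Y v

  _∪_ : Sub → Sub → Sub
  (X ∪ Y) v = X v ⊎ Y v

  Disjoint : Sub → Sub → Set
  Disjoint X Y = ∀ {v} → X v → Y v → ⊥

  NonEmpty : Sub → Set
  NonEmpty X = ∃ λ v → X v

  ⋃ : List Sub → Sub
  ⋃ []       v = ⊥
  ⋃ (Y ∷ Ys) v = Y v ⊎ ⋃ Ys v

  data Reach (X : Sub) (x : V) : V → Set where
    here : X x → Reach X x x
    step : ∀ {y z} → Reach X x y → E y z → X z → Reach X x z

  -- connected subsets (the empty set is connected)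
  Connected : Sub → Set
  Connected X = ∀ {x y} → X x → X y → Reach X x y

  𝒞 : Fam
  𝒞 X = Lift (lsuc 0ℓ) (NonEmpty X × Connected X)

  _⊑_ : Fam → Fam → Set₁
  𝒙 ⊑ 𝒚 = ∀ X → 𝒙 X → 𝒚 X

  _≋_ : Fam → Fam → Set₁
  𝒙 ≋ 𝒚 = (𝒙 ⊑ 𝒚) × (𝒚 ⊑ 𝒙)

  _⊏_ : Fam → Fam → Set₁
  𝒙 ⊏ 𝒚 = (𝒙 ⊑ 𝒚) × ¬ (𝒚 ⊑ 𝒙)

  _∈ₑ_ : Sub → Fam → Set₁
  X ∈ₑ 𝒙 = Σ Sub λ Y → 𝒙 Y × (Y ≐ X)

  φ : Fam → Fam
  φ 𝒙 X = 𝒞 X × Σ (List Sub) λ Ys →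
            (¬ (Ys ≡L [])) × All 𝒙 Ys × AllPairs Disjoint Ys × (X ≐ ⋃ Ys)
    where
      open import Relation.Binary.PropositionalEquality using () renaming (_≡_ to _≡L_)

  𝒞∖ : Fam → Fam
  𝒞∖ 𝒙 X = 𝒞 X × ¬ 𝒙 X

  φ̌ : Fam → Fam
  φ̌ 𝒙 = 𝒞∖ (φ (𝒞∖ 𝒙))

  IsRegClosed : Fam → Set₁
  IsRegClosed 𝒙 = (𝒙 ⊑ 𝒞) × (𝒙 ≋ φ (φ̌ 𝒙))

  IsLowerCover : Fam → Fam → Set₂
  IsLowerCover b a = IsRegClosed b × (b ⊏ a) ×
    (∀ z → IsRegClosed z → b ⊏ z → ¬ (z ⊏ a))

  CompletelyJoinIrreducible : Fam → Set₂
  CompletelyJoinIrreducible a = Σ Fam λ a* →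
      IsLowerCover a* a
    × (∀ b → IsLowerCover b a → b ≋ a*)
    × (∀ y → IsRegClosed y → y ⊏ a → y ⊑ a*)

  IsCut : Sub → Sub → Set
  IsCut H X = NonEmpty X × (X ⊆ H) × Connected X × Connected (H ∖ X)

  record IsPseudoUltrafilter (H : Sub) (μ : Fam) : Set₁ where
    field
      cuts  : ∀ X → μ X → IsCut H X
      top   : H ∈ₑ μ
      join  : ∀ X Y Z → IsCut H X → IsCut H Y → IsCut H Z →
              Z ≐ (X ∪ Y) → Disjoint X Y →
              X ∈ₑ μ → Y ∈ₑ μ → Z ∈ₑ μ
      meet  : ∀ X Y Z → IsCut H X → IsCut H Y → IsCut H Z →
              Z ≐ (X ∪ Y) → Disjoint X Y →
              ¬ (X ∈ₑ μ) → ¬ (Y ∈ₑ μ) → ¬ (Z ∈ₑ μ)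
      compl : ∀ X → IsCut H X → ¬ (X ≐ H) →
              (X ∈ₑ μ → ¬ ((H ∖ X) ∈ₑ μ)) × (¬ ((H ∖ X) ∈ₑ μ) → X ∈ₑ μ)

  IsComponent : Sub → Sub → Set₁
  IsComponent S C = NonEmpty C × Connected C × (C ⊆ S) ×
    (∀ D → Connected D → C ⊆ D → D ⊆ S → D ⊆ C)

  𝚓 : Sub → Fam → Fam
  𝚓 H μ X = NonEmpty X × Connected X × (X ⊆ H) ×
    Σ (List Sub) λ Cs →
        All (IsComponent (H ∖ X)) Cs
      × (∀ C → IsComponent (H ∖ X) C → Any (C ≐_) Cs)
      × (∀ C → IsComponent (H ∖ X) C → ¬ (C ∈ₑ μ))

-- Call a connected X ⊆ H a P-kernel if H ∖ X has finitely many components, all satisfying P; thus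
-- 𝚓(μ) consists of the (∉ μ)-kernels.  If P is closed under disjoint unions of cuts and
-- holds for H ∖ X whenever it fails for a proper cut X, then in every finite partition of a P-kernel
-- into connected sets some part is a P-kernel.  For P = (∉ μ) this says that 𝚓(μ) is open, so φ(𝚓(μ))
-- is regular closed.  For P = (∈ μ) it shows that φ(𝚓(μ)) contains no cut outside μ, and that H is not
-- a disjoint union of two or more members of 𝚓(μ).  Hence a regular closed set strictly below
-- φ(𝚓(μ)) misses H from its interior, and the largest one is the closure of the interior of
-- φ(𝚓(μ)) ∖ {H}.
--
-- Conversely, let a be completely join-irreducible and H ∈ φ̌(a) ∖ a*.  Every X ∈ a with H ⊈ X
-- belongs to a*, because the closure of { Y ∈ φ̌(a) | Y ⊆ X } is a regular closed subset of a
-- that omits H.  So a proper cut of H and its complement are never both in a (H would be in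
-- a*), and the cuts of H belonging to a form a pseudo-ultrafilter μ.  Openness of φ̌(a) gives
-- 𝚓(μ) ⊆ φ̌(a), and then a = φ(𝚓(μ)), since φ(𝚓(μ)) contains H and so is not below a*.

module Submission where

open import Level using (Level; lift; lower)
open import Axiom.ExcludedMiddle using (ExcludedMiddle)
open import Data.Empty using (⊥-elim)
open import Data.List using (List; []; _∷_; _++_; [_]; length; filter)
open import Data.List.Membership.Propositional using (_∈_)
open import Data.List.Membership.Propositional.Properties using (∈-filter⁺; ∈-filter⁻; ∈-∃++; ∈-++⁺ˡ; ∈-++⁺ʳ; ∈-++⁻)
open import Data.List.Relation.Binary.Permutation.Propositional using (_↭_; refl; prep; swap; trans; ↭-sym)
open import Data.List.Relation.Binary.Permutation.Propositional.Properties using (shift; ↭-length; ∈-resp-↭; All-resp-↭)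
open import Data.List.Relation.Unary.All as All using (All; []; _∷_)
open import Data.List.Relation.Unary.All.Properties using (all-filter) renaming (filter⁺ to All-filter⁺; ++⁺ to All-++⁺)
open import Data.List.Relation.Unary.AllPairs using (AllPairs; []; _∷_)
open import Data.List.Relation.Unary.AllPairs.Properties using () renaming (filter⁺ to AllPairs-filter⁺; ++⁺ to AllPairs-++⁺)
open import Data.List.Relation.Unary.Any as Any using (Any)
open import Data.Nat using (zero; suc)
open import Data.Nat.Properties using (suc-injective)
open import Data.Product using (Σ; ∃₂; _×_; _,_; proj₁; proj₂)
open import Data.Sum using (_⊎_; inj₁; inj₂)
open import Function using (_∘_; id)
open import Function.Bundles using (_⇔_; mk⇔)
open import Relation.Binary.PropositionalEquality using (_≡_; refl; sym) renaming (trans to ≡-trans)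
open import Relation.Nullary using (¬_; Dec; yes; no)
import Defs

-- Pairwise relations on permuted lists.

AllPairs-resp-↭ : ∀ {a r} {A : Set a} {R : A → A → Set r} → (∀ {x y} → R x y → R y x) →
  ∀ {xs ys} → xs ↭ ys → AllPairs R xs → AllPairs R ys
AllPairs-resp-↭ s refl         rs                         = rs
AllPairs-resp-↭ s (prep x p)   (r ∷ rs)                   = All-resp-↭ p r ∷ AllPairs-resp-↭ s p rs
AllPairs-resp-↭ s (swap x y p) ((rxy ∷ rx) ∷ (ry ∷ rs))   =
  (s rxy ∷ All-resp-↭ p ry) ∷ (All-resp-↭ p rx ∷ AllPairs-resp-↭ s p rs)
AllPairs-resp-↭ s (trans p q)  rs                         = AllPairs-resp-↭ s q (AllPairs-resp-↭ s p rs)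

module RegularClosedFamilies (em : {ℓ : Level} → ExcludedMiddle ℓ) (G : Defs.Graph) where

  open Defs.Graph G

  Sub = Defs.Sub G
  Fam = Defs.Fam G

  private
    variable
      X Y Z S T A B C D H W : Sub
      Cs Ds Xs Ys : List Sub
      x y z : V

  infix 4 _⊆_ _≐_
  infixl 6 _∖_ _∪_

  _⊆_ _≐_ Disjoint : Sub → Sub → Set
  _⊆_ = Defs._⊆_ G
  _≐_ = Defs._≐_ G
  Disjoint = Defs.Disjoint G

  _∖_ _∪_ : Sub → Sub → Sub
  _∖_ = Defs._∖_ G
  _∪_ = Defs._∪_ G

  ⋃ : List Sub → Sub
  ⋃ = Defs.⋃ G

  Connected NonEmpty : Sub → Set
  Connected = Defs.Connected G
  NonEmpty = Defs.NonEmpty G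

  Reach = Defs.Reach G
  IsComponent = Defs.IsComponent G
  IsCut = Defs.IsCut G

  -- Classical reasoning and the algebra of finite unions.

  decide : ∀ {ℓ} (P : Set ℓ) → Dec P
  decide P = em

  dne : ∀ {ℓ} {P : Set ℓ} → ¬ ¬ P → P
  dne {P = P} ¬¬p with decide P
  ... | yes p = p
  ... | no ¬p = ⊥-elim (¬¬p ¬p)

  ≐-sym : X ≐ Y → Y ≐ X
  ≐-sym (p , q) = q , p

  ≐-trans : X ≐ Y → Y ≐ Z → X ≐ Z
  ≐-trans (p , q) (p′ , q′) = p′ ∘ p , q ∘ q′

  ∖∖ : X ⊆ H → H ∖ (H ∖ X) ≐ X
  ∖∖ X⊆H = (λ (h , ¬hx) → dne λ ¬x → ¬hx (h , ¬x)) , λ x → X⊆H x , λ (_ , ¬x) → ¬x x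

  ∪-comm : A ∪ B ≐ B ∪ A
  ∪-comm = (λ { (inj₁ a) → inj₂ a ; (inj₂ b) → inj₁ b }) , λ { (inj₁ b) → inj₂ b ; (inj₂ a) → inj₁ a }

  ∖-≐ : X ≐ Y → H ∖ X ≐ H ∖ Y
  ∖-≐ (s , t) = (λ (h , ¬x) → h , ¬x ∘ t) , λ (h , ¬y) → h , ¬y ∘ s

  ⋃⁺ : C ∈ Cs → C ⊆ ⋃ Cs
  ⋃⁺ (Any.here refl) c = inj₁ c
  ⋃⁺ (Any.there i)   c = inj₂ (⋃⁺ i c)

  ⋃⁻ : ∀ Cs → ⋃ Cs x → Σ Sub λ C → C ∈ Cs × C x
  ⋃⁻ (C ∷ Cs) (inj₁ c) = C , Any.here refl , c
  ⋃⁻ (C ∷ Cs) (inj₂ c) with ⋃⁻ Cs c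
  ... | D , i , d = D , Any.there i , d

  ⋃-↭ : Xs ↭ Ys → ⋃ Xs ⊆ ⋃ Ys
  ⋃-↭ {Xs} p m with ⋃⁻ Xs m
  ... | C , i , c = ⋃⁺ (∈-resp-↭ p i) c

  extract : X ∈ Xs → Σ (List Sub) λ Ys → Xs ↭ X ∷ Ys
  extract {X} i with ∈-∃++ i
  ... | Ys , Zs , refl = Ys ++ Zs , shift X Ys Zs

  -- Serves to sort the components around a split set `A ∪ B`: those touching one half are the ones
  -- missing the other half together with the ones touching both.
  filter-∪ : ∀ {p q r} {P : Sub → Set p} {Q : Sub → Set q} {R : Sub → Set r}
    (P? : ∀ C → Dec (P C)) (Q? : ∀ C → Dec (Q C)) (R? : ∀ C → Dec (R C)) Cs →
    (∀ {C} → C ∈ Cs → P C → Q C ⊎ R C) → (∀ {C} → C ∈ Cs → Q C → P C) → (∀ {C} → C ∈ Cs → R C → P C) →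
    Z ∪ ⋃ (filter P? Cs) ≐ (Z ∪ ⋃ (filter Q? Cs)) ∪ ⋃ (filter R? Cs)
  filter-∪ {Z = Z} P? Q? R? Cs P⇒ Q⇒ R⇒ = to , from
    where
    to : Z ∪ ⋃ (filter P? Cs) ⊆ (Z ∪ ⋃ (filter Q? Cs)) ∪ ⋃ (filter R? Cs)
    to (inj₁ z) = inj₁ (inj₁ z)
    to (inj₂ m) with ⋃⁻ _ m
    ... | C , i , c with ∈-filter⁻ P? i
    ...   | i′ , p with P⇒ i′ p
    ...     | inj₁ q = inj₁ (inj₂ (⋃⁺ (∈-filter⁺ Q? i′ q) c))
    ...     | inj₂ r = inj₂ (⋃⁺ (∈-filter⁺ R? i′ r) c)

    from : (Z ∪ ⋃ (filter Q? Cs)) ∪ ⋃ (filter R? Cs) ⊆ Z ∪ ⋃ (filter P? Cs)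
    from (inj₁ (inj₁ z)) = inj₁ z
    from (inj₁ (inj₂ m)) with ⋃⁻ _ m
    ... | C , i , c with ∈-filter⁻ Q? i
    ...   | i′ , q = inj₂ (⋃⁺ (∈-filter⁺ P? i′ (Q⇒ i′ q)) c)
    from (inj₂ m) with ⋃⁻ _ m
    ... | C , i , c with ∈-filter⁻ R? i
    ...   | i′ , r = inj₂ (⋃⁺ (∈-filter⁺ P? i′ (R⇒ i′ r)) c)

  disjoint-sym : Disjoint X Y → Disjoint Y X
  disjoint-sym d y x = d x y

  -- Walks and connected sets.

  reach-end : Reach X x y → X y
  reach-end (Defs.here p)     = p
  reach-end (Defs.step _ _ p) = p

  reach-mono : X ⊆ Y → Reach X x y → Reach Y x y
  reach-mono s (Defs.here p)     = Defs.here (s p)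
  reach-mono s (Defs.step r e p) = Defs.step (reach-mono s r) e (s p)

  reach-trans : Reach X x y → Reach X y z → Reach X x z
  reach-trans r (Defs.here _)      = r
  reach-trans r (Defs.step r′ e p) = Defs.step (reach-trans r r′) e p

  reach-sym : Reach X x y → Reach X y x
  reach-sym (Defs.here p)     = Defs.here p
  reach-sym (Defs.step r e p) =
    reach-trans (Defs.step (Defs.here p) (E-sym e) (reach-end r)) (reach-sym r)

  -- The walk is searched backwards from its end, deciding at each step whether the preceding vertex
  -- lies in `B`.
  reach-exit : Reach X x y → B x → ¬ B y → ∃₂ λ u v → X v × B u × ¬ B v × E u v
  reach-exit (Defs.here _) b ¬b = ⊥-elim (¬b b)
  reach-exit {B = B} (Defs.step {y = u} r e p) b ¬b with decide (B u)
  ... | yes bu = u , _ , p , bu , ¬b , e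
  ... | no ¬bu = reach-exit {B = B} r b ¬bu

  connected-from : (∀ {y} → X y → Reach X x y) → Connected X
  connected-from f p q = reach-trans (reach-sym (f p)) (f q)

  connected-≐ : X ≐ Y → Connected X → Connected Y
  connected-≐ (p , q) c x y = reach-mono p (c (q x) (q y))

  Adj : Sub → Sub → Set
  Adj A B = ∃₂ λ u v → A u × B v × E u v

  adj-⊆ : A ⊆ B → Adj A C → Adj B C
  adj-⊆ s (u , v , a , c , e) = u , v , s a , c , e

  connected-∪ : Connected A → Connected B → Adj A B → Connected (A ∪ B)
  connected-∪ {A} {B} cA cB (u , v , a , b , e) = connected-from f
    where
    f : (A ∪ B) y → Reach (A ∪ B) u y
    f (inj₁ p) = reach-mono inj₁ (cA a p)
    f (inj₂ p) = reach-trans (Defs.step (Defs.here (inj₁ a)) e (inj₂ b)) (reach-mono inj₂ (cB b p))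

  -- Every `C` touches the centre `Z` itself, so the pieces can be absorbed into the centre one by
  -- one; enlarging the centre preserves the remaining adjacencies.
  connected-star : ∀ Cs → Connected Z → All Connected Cs → All (Adj Z) Cs → Connected (Z ∪ ⋃ Cs)
  connected-star []       cZ []         []       = connected-≐ (inj₁ , λ { (inj₁ z) → z ; (inj₂ ()) }) cZ
  connected-star (C ∷ Cs) cZ (cC ∷ cCs) (a ∷ as) =
    connected-≐
      ( (λ { (inj₁ (inj₁ z)) → inj₁ z ; (inj₁ (inj₂ c)) → inj₂ (inj₁ c) ; (inj₂ d) → inj₂ (inj₂ d) })
      , (λ { (inj₁ z) → inj₁ (inj₁ z) ; (inj₂ (inj₁ c)) → inj₁ (inj₂ c) ; (inj₂ (inj₂ d)) → inj₂ d }))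
      (connected-star Cs (connected-∪ cZ cC a) cCs (All.map (adj-⊆ inj₁) as))

  -- Connected components.

  component-connected : IsComponent S C → Connected C
  component-connected (_ , c , _) = c

  component-⊆ : IsComponent S C → C ⊆ S
  component-⊆ (_ , _ , s , _) = s

  -- A local, edgewise form of maximality: a nonempty connected `C ⊆ S` is a component of `S`
  -- exactly when it is closed in this sense.
  Closed : Sub → Sub → Set
  Closed S C = ∀ {y z} → C y → E y z → S z → C z

  component-closed : IsComponent S C → Closed S C
  component-closed {S} {C} (_ , cC , C⊆S , max) {y} {z} cy e sz =
    max (C ∪ (_≡ z)) (connected-∪ cC (λ { refl refl → Defs.here refl }) (y , z , cy , refl , e))
      inj₁ (λ { (inj₁ c) → C⊆S c ; (inj₂ refl) → sz }) (inj₂ refl)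

  component-≐ : S ≐ T → IsComponent S C → IsComponent T C
  component-≐ (s , t) (ne , cC , sub , max) = ne , cC , s ∘ sub ,
    λ D cD C⊆D D⊆T → max D cD C⊆D (t ∘ D⊆T)

  reach-closed : Closed S C → Reach S x y → C x → C y
  reach-closed cl (Defs.here _)     c = c
  reach-closed cl (Defs.step r e p) c = cl (reach-closed cl r c) e p

  closed⇒component : NonEmpty C → Connected C → C ⊆ S → Closed S C → IsComponent S C
  closed⇒component (x , c) cC C⊆S cl = (x , c) , cC , C⊆S ,
    λ D cD C⊆D D⊆S d → reach-closed cl (reach-mono D⊆S (cD (C⊆D c) d)) c

  component-meet : IsComponent S C → IsComponent S D → C x → D x → C ≐ D
  component-meet p q c d = sub p q c d , sub q p d c
    where
    sub : IsComponent S A → IsComponent S B → A x → B x → A ⊆ B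
    sub (_ , cA , A⊆S , _) q a b a′ =
      reach-closed (component-closed q) (reach-mono A⊆S (cA a a′)) b

  -- Every initial segment of a walk from `x` in `S` ends at a vertex reachable from `x`, so the
  -- walk stays inside the set of reachable vertices.
  componentAt : S x → IsComponent S (Reach S x)
  componentAt {S} {x} s = closed⇒component (x , Defs.here s) (connected-from (lift-reach)) reach-end Defs.step
    where
    lift-reach : Reach S x y → Reach (Reach S x) x y
    lift-reach (Defs.here p)     = Defs.here (Defs.here p)
    lift-reach (Defs.step r e p) = Defs.step (lift-reach r) e (Defs.step r e p)

  -- Unlike the lists in `𝚓`, these have no repetitions, so they can be used directly as partitions
  -- in the sense of `φ`.
  Components : Sub → List Sub → Set₁
  Components S Cs = All (IsComponent S) Cs × AllPairs Disjoint Cs × S ⊆ ⋃ Cs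

  -- Components that meet are equal, so dropping repetitions up to `≐` leaves pairwise disjoint
  -- sets.
  components-disjoint : ∀ Cs → All (IsComponent S) Cs →
    Σ (List Sub) λ Ds → All (IsComponent S) Ds × AllPairs Disjoint Ds × ⋃ Cs ⊆ ⋃ Ds
  components-disjoint []       []       = [] , [] , [] , id
  components-disjoint (C ∷ Cs) (p ∷ ps) with components-disjoint Cs ps
  ... | Ds , qs , disj , sub with decide (Any (C ≐_) Ds)
  ...   | yes i = Ds , qs , disj , λ { (inj₁ c) → cover i c ; (inj₂ c) → sub c }
    where
    cover : ∀ {Ds} → Any (C ≐_) Ds → C ⊆ ⋃ Ds
    cover (Any.here (s , _)) c = inj₁ (s c)
    cover (Any.there i)      c = inj₂ (cover i c)
  ...   | no ¬i = C ∷ Ds , p ∷ qs ,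
    All.tabulate (λ {D} i c d → ¬i (Any.map (λ { refl → component-meet p (All.lookup qs i) c d }) i)) ∷ disj ,
    λ { (inj₁ c) → inj₁ c ; (inj₂ c) → inj₂ (sub c) }

  components-complete : Components S Cs → IsComponent S C → Any (C ≐_) Cs
  components-complete {Cs = Cs} (ps , _ , sub) q@((x , c) , _ , C⊆S , _) with ⋃⁻ Cs (sub (C⊆S c))
  ... | D , i , d = Any.map (λ { refl → component-meet q (All.lookup ps i) c d }) i

  -- Components and cuts inside a connected set.

  module InConnected (H : Sub) (H-conn : Connected H) where

    -- A walk in `H` from `C` to `X` leaves `C` along some edge, and as `C` is closed in `H ∖ X`
    -- that edge can only lead into `X`.
    component-adj : NonEmpty X → X ⊆ H → IsComponent (H ∖ X) C → Adj X C
    component-adj {X} {C} (x , px) X⊆H q@((c , pc) , _ , C⊆S , _)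
      with reach-exit {B = C} (H-conn (proj₁ (C⊆S pc)) (X⊆H px)) pc (λ cx → proj₂ (C⊆S cx) px)
    ... | u , v , hv , cu , ¬cv , e =
      v , u , dne (λ ¬xv → ¬cv (component-closed q cu e (hv , ¬xv))) , cu , E-sym e

    component-cut : NonEmpty X → Connected X → X ⊆ H → IsComponent (H ∖ X) C → IsCut H C
    component-cut {X} {C} (x , px) cX X⊆H q@(ne , cC , C⊆S , _) =
      ne , proj₁ ∘ C⊆S , cC , connected-from λ (h , ¬c) → walk (H-conn (X⊆H px) h) ¬c
      where
      X⊆ : X ⊆ H ∖ C
      X⊆ p = X⊆H p , λ c → proj₂ (C⊆S c) p

      walk : Reach H x z → ¬ C z → Reach (H ∖ C) x z
      walk (Defs.here h) ¬c = Defs.here (h , ¬c)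
      walk (Defs.step {y = y} r e h) ¬c with decide (C y)
      ... | no ¬cy = Defs.step (walk r ¬cy) e (h , ¬c)
      -- A walk can leave `C` only into `X`, so `z` lies in `X`; the detour through `C` is replaced
      -- by a walk inside the connected set `X`.
      ... | yes cy = reach-mono X⊆ (cX px (dne λ ¬xz → ¬c (component-closed q cy e (h , ¬xz))))

    -- Collects what membership and non-membership in a pseudo-ultrafilter have in common, so that
    -- one argument about kernels serves both.
    record IsCutClass (P : Fam) : Set₁ where
      field
        resp  : X ≐ Y → P X → P Y
        join  : IsCut H X → IsCut H Y → IsCut H (X ∪ Y) → Disjoint X Y → P X → P Y → P (X ∪ Y)
        compl : IsCut H X → ¬ (X ≐ H) → ¬ P X → P (H ∖ X)

    -- Kernels and their behaviour under partitions.

    module Kernel (P : Fam) (isCutClass : IsCutClass P) where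
      open IsCutClass isCutClass

      Kernel : Fam
      Kernel X = NonEmpty X × Connected X × (X ⊆ H) ×
        Σ (List Sub) λ Cs → Components (H ∖ X) Cs × All P Cs

      kernel-≐ : X ≐ Y → Kernel X → Kernel Y
      kernel-≐ eq@(s , t) ((x , p) , cX , X⊆H , Cs , (qs , disj , sub) , Ps) =
        (x , s p) , connected-≐ eq cX , X⊆H ∘ t , Cs ,
        (All.map (component-≐ (∖-≐ eq)) qs ,
          disj , λ (h , ¬y) → sub (h , ¬y ∘ s)) , Ps

      -- `A` and `B ∪ ⋃ Ms` are the two sides of a cut. As each `M` touches both `A` and `B`, moving
      -- it across leaves both sides connected; every intermediate set is thus a cut, and `join`
      -- applies each time.
      absorb : ∀ Ms → NonEmpty A → Connected A → Connected B → H ∖ A ≐ B ∪ ⋃ Ms → A ⊆ H →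
        AllPairs Disjoint Ms → All (Disjoint B) Ms → All (IsCut H) Ms →
        All (Adj A) Ms → All (Adj B) Ms → All P Ms → P A → P (A ∪ ⋃ Ms)
      absorb [] neA cA cB eq A⊆H [] [] [] [] [] [] PA = resp (inj₁ , λ { (inj₁ a) → a ; (inj₂ ()) }) PA
      absorb {A} {B} (M ∷ Ms) (x , ax) cA cB eq@(to , from) A⊆H (dM ∷ dMs) (dB ∷ dBs)
             (cutM@(neM , M⊆H , cM , _) ∷ cutMs) (aM ∷ aMs) (bM ∷ bMs) (PM ∷ PMs) PA =
        resp ((λ { (inj₁ (inj₁ a)) → inj₁ a ; (inj₁ (inj₂ m)) → inj₂ (inj₁ m) ; (inj₂ n) → inj₂ (inj₂ n) })
             , (λ { (inj₁ a) → inj₁ (inj₁ a) ; (inj₂ (inj₁ m)) → inj₁ (inj₂ m) ; (inj₂ (inj₂ n)) → inj₂ n }))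
          (absorb Ms (x , inj₁ ax) cAM cB eq′ AM⊆H dMs dBs cutMs (All.map (adj-⊆ inj₁) aMs) bMs PMs
            (join cutA cutM cutAM (λ a m → proj₂ (from (inj₂ (inj₁ m))) a) PA PM))
        where
        conns : ∀ {Ns} → All (IsCut H) Ns → All Connected Ns
        conns = All.map λ (_ , _ , c , _) → c

        disjointMs : ⋃ Ms z → ¬ M z
        disjointMs n m with ⋃⁻ Ms n
        ... | N , i , nz = All.lookup dM i m nz

        cAM : Connected (A ∪ M)
        cAM = connected-∪ cA cM aM

        AM⊆H : A ∪ M ⊆ H
        AM⊆H (inj₁ a) = A⊆H a
        AM⊆H (inj₂ m) = M⊆H m

        eq′ : H ∖ (A ∪ M) ≐ B ∪ ⋃ Ms
        eq′ = (λ (h , ¬am) → outside (to (h , ¬am ∘ inj₁)) (¬am ∘ inj₂))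
            , λ { (inj₁ b) → proj₁ (from (inj₁ b)) ,
                    λ { (inj₁ a) → proj₂ (from (inj₁ b)) a ; (inj₂ m) → dB b m }
                ; (inj₂ n) → proj₁ (from (inj₂ (inj₂ n))) ,
                    λ { (inj₁ a) → proj₂ (from (inj₂ (inj₂ n))) a ; (inj₂ m) → disjointMs n m } }
          where
          outside : (B ∪ ⋃ (M ∷ Ms)) z → ¬ M z → (B ∪ ⋃ Ms) z
          outside (inj₁ b)        ¬m = inj₁ b
          outside (inj₂ (inj₁ m)) ¬m = ⊥-elim (¬m m)
          outside (inj₂ (inj₂ n)) ¬m = inj₂ n

        cutA : IsCut H A
        cutA = (x , ax) , A⊆H , cA ,
          connected-≐ (≐-sym eq) (connected-star (M ∷ Ms) cB (cM ∷ conns cutMs) (bM ∷ bMs))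

        cutAM : IsCut H (A ∪ M)
        cutAM = (x , inj₁ ax) , AM⊆H , cAM ,
          connected-≐ (≐-sym eq′) (connected-star Ms cB (conns cutMs) bMs)

      adj? : ∀ Z C → Dec (Adj Z C)
      adj? Z C = decide (Adj Z C)

      nonadj? : ∀ Z C → Dec (¬ Adj Z C)
      nonadj? Z C = decide (¬ Adj Z C)

      -- If `W` is the disjoint union of `A` and `B`, and `Cs` lists the components of `H ∖ W`, then
      -- `attached B Cs` is the component of `H ∖ A` containing the connected set `B`.
      attached : Sub → List Sub → Sub
      attached Z Cs = Z ∪ ⋃ (filter (adj? Z) Cs)

      module _ (eq : W ≐ A ∪ B) (A#B : Disjoint A B) (W⊆H : W ⊆ H)
               (neB : NonEmpty B) (cB : Connected B) (comps : Components (H ∖ W) Cs) where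
        private
          qs = proj₁ comps
          disj = proj₁ (proj₂ comps)
          cover = proj₂ (proj₂ comps)

          conns : All Connected Cs
          conns = All.map (λ {C} → component-connected {C = C}) qs

          outsideW : (H ∖ A) z → ¬ B z → (H ∖ W) z
          outsideW (h , ¬a) ¬b = h , λ w → case (proj₁ eq w)
            where
            case : ¬ (A ∪ B) _
            case (inj₁ a) = ¬a a
            case (inj₂ b) = ¬b b

          outsideA : H ∖ W ⊆ H ∖ A
          outsideA (h , ¬w) = h , λ a → ¬w (proj₂ eq (inj₁ a))

          inside : C ∈ Cs → C ⊆ H ∖ W
          inside i = proj₁ (proj₂ (proj₂ (All.lookup qs i)))

        attached-component : IsComponent (H ∖ A) (attached B Cs)
        attached-component = closed⇒component (proj₁ neB , inj₁ (proj₂ neB))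
          (connected-star _ cB (All-filter⁺ (adj? B) conns) (all-filter (adj? B) Cs))
          sub cl
          where
          sub : attached B Cs ⊆ H ∖ A
          sub (inj₁ b) = W⊆H (proj₂ eq (inj₂ b)) , λ a → A#B a b
          sub (inj₂ m) with ⋃⁻ _ m
          ... | C , i , c = outsideA (inside (proj₁ (∈-filter⁻ (adj? B) i)) c)

          cl : Closed (H ∖ A) (attached B Cs)
          cl {z = z} p e s with decide (B z)
          cl p e s | yes b = inj₁ b
          cl (inj₁ b) e s | no ¬b with ⋃⁻ Cs (cover (outsideW s ¬b))
          ... | C , i , c = inj₂ (⋃⁺ (∈-filter⁺ (adj? B) i (_ , _ , b , c , e)) c)
          cl (inj₂ m) e s | no ¬b with ⋃⁻ _ m
          ... | C , i , c = inj₂ (⋃⁺ i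
            (component-closed (All.lookup qs (proj₁ (∈-filter⁻ (adj? B) i))) c e (outsideW s ¬b)))

        -- Passing from `H ∖ W` to `H ∖ A` adds only vertices of `B`, and no edge joins these to
        -- `C`.
        nonadj-component : C ∈ Cs → ¬ Adj B C → IsComponent (H ∖ A) C
        nonadj-component {C} i ¬adj with All.lookup qs i
        ... | q@(ne , cC , C⊆ , _) = closed⇒component ne cC (outsideA ∘ C⊆) cl
          where
          cl : Closed (H ∖ A) C
          cl {y} {z} c e s with decide (B z)
          ... | yes b = ⊥-elim (¬adj (z , y , b , c , E-sym e))
          ... | no ¬b = component-closed q c e (outsideW s ¬b)

        attached-cut : NonEmpty A → Connected A → IsCut H (attached B Cs)
        attached-cut neA cA = component-cut neA cA (λ a → W⊆H (proj₂ eq (inj₁ a))) attached-component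

        private
          nonadj⁻ : C ∈ filter (nonadj? B) Cs → C ∈ Cs × ¬ Adj B C
          nonadj⁻ = ∈-filter⁻ (nonadj? B)

        attached#nonadj : C ∈ Cs → ¬ Adj B C → Disjoint (attached B Cs) C
        attached#nonadj i ¬adj (inj₁ b) c = proj₂ (inside i c) (proj₂ eq (inj₂ b))
        attached#nonadj i ¬adj (inj₂ m) c with ⋃⁻ _ m
        ... | D , j , d with ∈-filter⁻ (adj? B) j
        ...   | j′ , u , v , b , dv , e = ¬adj
          (u , v , b , proj₁ (component-meet (All.lookup qs j′) (All.lookup qs i) d c) dv , e)

        attached-components : Components (H ∖ A) (attached B Cs ∷ filter (nonadj? B) Cs)
        attached-components =
          attached-component ∷ All.tabulate (λ i → let i′ , n = nonadj⁻ i in nonadj-component i′ n) ,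
          All.tabulate (λ i → let i′ , n = nonadj⁻ i in attached#nonadj i′ n) ∷ AllPairs-filter⁺ (nonadj? B) disj ,
          covers
          where
          covers : H ∖ A ⊆ ⋃ (attached B Cs ∷ filter (nonadj? B) Cs)
          covers {z} s with decide (B z)
          ... | yes b = inj₁ (inj₁ b)
          ... | no ¬b with ⋃⁻ Cs (cover (outsideW s ¬b))
          ...   | C , i , c with decide (Adj B C)
          ...     | yes a = inj₁ (inj₂ (⋃⁺ (∈-filter⁺ (adj? B) i a) c))
          ...     | no ¬a = inj₂ (⋃⁺ (∈-filter⁺ (nonadj? B) i ¬a) c)

        complement-attached : H ∖ attached B Cs ≐ A ∪ ⋃ (filter (nonadj? B) Cs)
        complement-attached = to , from
          where
          to : H ∖ attached B Cs ⊆ A ∪ ⋃ (filter (nonadj? B) Cs)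
          to {z} (h , ¬d) with decide (A z)
          ... | yes a = inj₁ a
          ... | no ¬a with ⋃⁻ Cs (cover (outsideW (h , ¬a) (¬d ∘ inj₁)))
          ...   | C , i , c = inj₂ (⋃⁺ (∈-filter⁺ (nonadj? B) i λ adj →
                    ¬d (inj₂ (⋃⁺ (∈-filter⁺ (adj? B) i adj) c))) c)

          from : A ∪ ⋃ (filter (nonadj? B) Cs) ⊆ H ∖ attached B Cs
          from (inj₁ a) = W⊆H (proj₂ eq (inj₁ a)) ,
            λ d → proj₂ (proj₁ (proj₂ (proj₂ attached-component)) d) a
          from (inj₂ m) with ⋃⁻ _ m
          ... | C , i , c with nonadj⁻ i
          ...   | i′ , ¬adj = proj₁ (inside i′ c) , λ d → attached#nonadj i′ ¬adj d c

        kernel-attached : NonEmpty A → Connected A → All P Cs → P (attached B Cs) → Kernel A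
        kernel-attached neA cA Ps PD =
          neA , cA , (λ a → W⊆H (proj₂ eq (inj₁ a))) , _ , attached-components ,
          PD ∷ All-filter⁺ (nonadj? B) Ps

      -- Suppose P fails for the component D of H ∖ B containing A.  Then P holds for H ∖ D, and
      -- adding to it, one at a time, the components of H ∖ W that touch both A and B yields the
      -- component of H ∖ A containing B.
      kernel-split : Kernel W → W ≐ A ∪ B → Disjoint A B → NonEmpty A → Connected A →
        NonEmpty B → Connected B → Kernel A ⊎ Kernel B
      kernel-split {W} {A} {B} (neW , cW , W⊆H , Cs , comps@(qs , disj , cover) , Ps) eq A#B neA@(_ , a₀) cA neB@(_ , b₀) cB
        with decide (P (attached A Cs))
      -- The components of `H ∖ B` are `attached A Cs` and the members of `Cs` not touching `A`, so
      -- here all of them satisfy `P`.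
      ... | yes PDᴬ = inj₂ (kernel-attached eq′ (λ b a → A#B a b) W⊆H neA cA comps neB cB Ps PDᴬ)
        where
        eq′ : W ≐ B ∪ A
        eq′ = ≐-trans eq ∪-comm
      ... | no ¬PDᴬ = inj₁ (kernel-attached eq A#B W⊆H neB cB comps neA cA Ps (resp target
              (absorb (filter both? Cs) (_ , inj₁ b₀) conn-Rᴮ conn-Rᴬ H∖Rᴮ≐Rᴬ∪both Rᴮ⊆H
                (AllPairs-filter⁺ both? disj) (All.tabulate Rᴬ#both)
                (All-filter⁺ both? (All.map (component-cut neW cW W⊆H) qs))
                (All.map (λ (_ , b) → adj-⊆ inj₁ b) (all-filter both? Cs))
                (All.map (λ (a , _) → adj-⊆ inj₁ a) (all-filter both? Cs))
                (All-filter⁺ both? Ps) (resp H∖Dᴬ≐Rᴮ (compl Dᴬ-cut Dᴬ≢H ¬PDᴬ)))))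
        where
        eq′ : W ≐ B ∪ A
        eq′ = ≐-trans eq ∪-comm

        both? : ∀ C → Dec (Adj A C × Adj B C)
        both? C = decide (Adj A C × Adj B C)

        adj-either : C ∈ Cs → Adj A C ⊎ Adj B C
        adj-either i with component-adj neW W⊆H (All.lookup qs i)
        ... | u , v , w , c , e with proj₁ eq w
        ...   | inj₁ a = inj₁ (u , v , a , c , e)
        ...   | inj₂ b = inj₂ (u , v , b , c , e)

        Dᴬ Rᴮ Rᴬ : Sub
        Dᴬ = attached A Cs
        Rᴮ = B ∪ ⋃ (filter (nonadj? A) Cs)
        Rᴬ = A ∪ ⋃ (filter (nonadj? B) Cs)

        H∖Dᴬ≐Rᴮ : H ∖ Dᴬ ≐ Rᴮ
        H∖Dᴬ≐Rᴮ = complement-attached eq′ (λ b a → A#B a b) W⊆H neA cA comps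

        H∖Dᴮ≐Rᴬ : H ∖ attached B Cs ≐ Rᴬ
        H∖Dᴮ≐Rᴬ = complement-attached eq A#B W⊆H neB cB comps

        Dᴬ-cut : IsCut H Dᴬ
        Dᴬ-cut = attached-cut eq′ (λ b a → A#B a b) W⊆H neA cA comps neB cB

        Dᴬ≢H : ¬ (Dᴬ ≐ H)
        Dᴬ≢H (_ , H⊆Dᴬ) = proj₂ (proj₂ H∖Dᴬ≐Rᴮ (inj₁ b₀)) (H⊆Dᴬ (proj₁ (proj₂ H∖Dᴬ≐Rᴮ (inj₁ b₀))))

        Rᴮ⊆H : Rᴮ ⊆ H
        Rᴮ⊆H = proj₁ ∘ proj₂ H∖Dᴬ≐Rᴮ

        conn-Rᴮ : Connected Rᴮ
        conn-Rᴮ = connected-≐ H∖Dᴬ≐Rᴮ (proj₂ (proj₂ (proj₂ Dᴬ-cut)))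

        conn-Rᴬ : Connected Rᴬ
        conn-Rᴬ = connected-≐ H∖Dᴮ≐Rᴬ (proj₂ (proj₂ (proj₂ (attached-cut eq A#B W⊆H neB cB comps neA cA))))

        Dᴬ≐Rᴬ∪both : Dᴬ ≐ Rᴬ ∪ ⋃ (filter both? Cs)
        Dᴬ≐Rᴬ∪both = filter-∪ (adj? A) (nonadj? B) both? Cs
          (λ {C} i a → case (decide (Adj B C)) a) (λ i ¬b → reject (adj-either i) ¬b) (λ _ → proj₁)
          where
          case : Dec (Adj B C) → Adj A C → ¬ Adj B C ⊎ (Adj A C × Adj B C)
          case (yes b) a = inj₂ (a , b)
          case (no ¬b) a = inj₁ ¬b

          reject : Adj A C ⊎ Adj B C → ¬ Adj B C → Adj A C
          reject (inj₁ a) ¬b = a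
          reject (inj₂ b) ¬b = ⊥-elim (¬b b)

        target : Rᴮ ∪ ⋃ (filter both? Cs) ≐ attached B Cs
        target = ≐-sym (filter-∪ (adj? B) (nonadj? A) both? Cs
          (λ {C} i b → case (decide (Adj A C)) b) (λ i ¬a → reject (adj-either i) ¬a) (λ _ → proj₂))
          where
          case : Dec (Adj A C) → Adj B C → ¬ Adj A C ⊎ (Adj A C × Adj B C)
          case (yes a) b = inj₂ (a , b)
          case (no ¬a) b = inj₁ ¬a

          reject : Adj A C ⊎ Adj B C → ¬ Adj A C → Adj B C
          reject (inj₁ a) ¬a = ⊥-elim (¬a a)
          reject (inj₂ b) ¬a = b

        H∖Rᴮ≐Rᴬ∪both : H ∖ Rᴮ ≐ Rᴬ ∪ ⋃ (filter both? Cs)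
        H∖Rᴮ≐Rᴬ∪both = ≐-trans (∖-≐ (≐-sym H∖Dᴬ≐Rᴮ)) (≐-trans (∖∖ (proj₁ (proj₂ Dᴬ-cut))) Dᴬ≐Rᴬ∪both)

        Rᴬ#both : C ∈ filter both? Cs → Disjoint Rᴬ C
        Rᴬ#both i f c with ∈-filter⁻ both? {xs = Cs} i
        ... | i′ , _ , b = proj₂ (proj₂ H∖Dᴮ≐Rᴬ f) (inj₂ (⋃⁺ (∈-filter⁺ (adj? B) i′ b) c))

      -- Two adjacent pieces are merged at each step, so that all intermediate unions stay connected.
      kernel-pieces : ∀ n X₁ Xs → length Xs ≡ n → Kernel X → X ≐ ⋃ (X₁ ∷ Xs) →
        All (λ Y → NonEmpty Y × Connected Y) (X₁ ∷ Xs) → AllPairs Disjoint (X₁ ∷ Xs) →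
        Σ Sub λ Y → Y ∈ X₁ ∷ Xs × Kernel Y
      kernel-pieces zero X₁ [] _ k eq _ _ =
        X₁ , Any.here refl , kernel-≐ (≐-trans eq ((λ { (inj₁ p) → p ; (inj₂ ()) }) , inj₁)) k
      kernel-pieces (suc n) X₁ (X₂ ∷ Xs) len k eq ((ne₁@(_ , p₁) , c₁) ∷ ps@((ne₂@(_ , p₂) , _) ∷ _)) (d₁ ∷ ds)
        with reach-exit {B = X₁} (proj₁ (proj₂ k) (proj₂ eq (inj₁ p₁)) (proj₂ eq (inj₂ (inj₁ p₂)))) p₁
               (λ q → All.lookup d₁ (Any.here refl) q p₂)
      ... | u , v , Xv , u₁ , ¬v₁ , e with proj₁ eq Xv
      ...   | inj₁ v₁ = ⊥-elim (¬v₁ v₁)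
      ...   | inj₂ vs with ⋃⁻ (X₂ ∷ Xs) vs
      ...     | Y , i , vY with extract i
      ...       | Ys , perm with All-resp-↭ perm ps | All-resp-↭ perm d₁ | AllPairs-resp-↭ disjoint-sym perm ds
      ...         | (neY , cY) ∷ ps′ | d₁Y ∷ d₁′ | dY ∷ ds′
        -- The recursion is on the number of pieces, because `Ys` arises from a permutation and is
        -- not a tail of the given list.
        with kernel-pieces n (X₁ ∪ Y) Ys (suc-injective (≡-trans (sym (↭-length perm)) len)) k eq′
               (((_ , inj₁ p₁) , connected-∪ c₁ cY (u , v , u₁ , vY , e)) ∷ ps′)
               (All.tabulate (λ { j (inj₁ x) z → All.lookup d₁′ j x z ; j (inj₂ y) z → All.lookup dY j y z }) ∷ ds′)
        where
        eq′ : _ ≐ (X₁ ∪ Y) ∪ ⋃ Ys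
        eq′ = ≐-trans eq
          ( (λ { (inj₁ x) → inj₁ (inj₁ x) ; (inj₂ m) → to (⋃-↭ perm m) })
          , λ { (inj₁ (inj₁ x)) → inj₁ x ; (inj₁ (inj₂ y)) → inj₂ (⋃-↭ (↭-sym perm) (inj₁ y))
              ; (inj₂ m) → inj₂ (⋃-↭ (↭-sym perm) (inj₂ m)) })
          where
          to : Y ∪ ⋃ Ys ⊆ (X₁ ∪ Y) ∪ ⋃ Ys
          to (inj₁ y) = inj₁ (inj₂ y)
          to (inj₂ m) = inj₂ m
      ...   | Z , Any.there j , kZ = Z , Any.there (∈-resp-↭ (↭-sym perm) (Any.there j)) , kZ
      -- The kernel found is the merged piece, so it is split back into its two halves.
      ...   | _ , Any.here refl , kXY with kernel-split kXY (id , id) d₁Y ne₁ c₁ neY cY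
      ...     | inj₁ k₁ = X₁ , Any.here refl , k₁
      ...     | inj₂ kY = Y , Any.there i , kY

  -- The closure `φ`, the interior `φ̌` and regular closed families.

  infix 4 _⊑_ _≋_ _⊏_ _∈ₑ_

  _⊑_ _≋_ _⊏_ : Fam → Fam → Set₁
  _⊑_ = Defs._⊑_ G
  _≋_ = Defs._≋_ G
  _⊏_ = Defs._⊏_ G

  _∈ₑ_ : Sub → Fam → Set₁
  _∈ₑ_ = Defs._∈ₑ_ G

  𝒞 : Fam
  𝒞 = Defs.𝒞 G

  φ φ̌ 𝒞∖ : Fam → Fam
  φ = Defs.φ G
  φ̌ = Defs.φ̌ G
  𝒞∖ = Defs.𝒞∖ G

  𝚓 : Sub → Fam → Fam
  𝚓 = Defs.𝚓 G

  IsRegClosed : Fam → Set₁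
  IsRegClosed = Defs.IsRegClosed G

  private
    variable
      𝒙 𝒚 a b : Fam

  𝒞-≐ : X ≐ Y → 𝒞 X → 𝒞 Y
  𝒞-≐ eq (lift ((x , p) , c)) = lift ((x , proj₁ eq p) , connected-≐ eq c)

  φ-≐ : X ≐ Y → φ 𝒙 X → φ 𝒙 Y
  φ-≐ eq (cX , Ys , ne , ys , disj , X≐) = 𝒞-≐ eq cX , Ys , ne , ys , disj , ≐-trans (≐-sym eq) X≐

  φ-mono : 𝒙 ⊑ 𝒚 → φ 𝒙 ⊑ φ 𝒚
  φ-mono s X (cX , Ys , ne , ys , rest) = cX , Ys , ne , All.map (λ {Y} → s Y) ys , rest

  -- The list cannot be empty because its union `X` is not.
  φ-⋃ : 𝒞 X → ∀ Ys → X ≐ ⋃ Ys → All 𝒙 Ys → AllPairs Disjoint Ys → φ 𝒙 X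
  φ-⋃ cX@(lift ((x , p) , _)) Ys eq ys disj = cX , Ys , nonempty eq , ys , disj , eq
    where
    nonempty : ∀ {Ys} → _ ≐ ⋃ Ys → ¬ (Ys ≡ [])
    nonempty eq refl = proj₁ eq p

  φ-pair : 𝒞 Z → Z ≐ X ∪ Y → Disjoint X Y → 𝒙 X → 𝒙 Y → φ 𝒙 Z
  φ-pair {X = X} {Y} cZ eq d x y = φ-⋃ cZ (X ∷ Y ∷ [])
    (≐-trans eq ((λ { (inj₁ p) → inj₁ p ; (inj₂ q) → inj₂ (inj₁ q) })
               , (λ { (inj₁ p) → inj₁ p ; (inj₂ (inj₁ q)) → inj₂ q ; (inj₂ (inj₂ ())) })))
    (x ∷ y ∷ []) (((λ p q → d p q) ∷ []) ∷ [] ∷ [])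

  φ-incl : 𝒞 X → 𝒙 X → φ 𝒙 X
  φ-incl {X} cX x = φ-⋃ cX [ X ] (inj₁ , λ { (inj₁ p) → p ; (inj₂ ()) }) (x ∷ []) ([] ∷ [])

  φ-flatten : ∀ Ys → All (φ 𝒙) Ys → AllPairs Disjoint Ys →
    Σ (List Sub) λ Zs → All 𝒙 Zs × AllPairs Disjoint Zs × ⋃ Ys ≐ ⋃ Zs
  φ-flatten []       []                                 []          = [] , [] , [] , id , id
  φ-flatten (Y ∷ Ys) ((_ , Zs , _ , zs , dZ , s , t) ∷ ys) (dY ∷ disj) with φ-flatten Ys ys disj
  ... | Zs′ , zs′ , dZ′ , s′ , t′ =
    Zs ++ Zs′ , All-++⁺ zs zs′ , AllPairs-++⁺ dZ dZ′ (All.tabulate λ i → All.tabulate λ j → apart i j)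
    , to , from
    where
    apart : A ∈ Zs → B ∈ Zs′ → Disjoint A B
    apart i j p q with ⋃⁻ Ys (t′ (⋃⁺ j q))
    ... | C , k , c = All.lookup dY k (t (⋃⁺ i p)) c

    to : ⋃ (Y ∷ Ys) ⊆ ⋃ (Zs ++ Zs′)
    to (inj₁ y) with ⋃⁻ Zs (s y)
    ... | C , i , c = ⋃⁺ (∈-++⁺ˡ i) c
    to (inj₂ y) with ⋃⁻ Zs′ (s′ y)
    ... | C , i , c = ⋃⁺ (∈-++⁺ʳ Zs i) c

    from : ⋃ (Zs ++ Zs′) ⊆ ⋃ (Y ∷ Ys)
    from m with ⋃⁻ (Zs ++ Zs′) m
    ... | C , i , c with ∈-++⁻ Zs i
    ...   | inj₁ j = inj₁ (t (⋃⁺ j c))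
    ...   | inj₂ j = inj₂ (t′ (⋃⁺ j c))

  φ-idem : φ (φ 𝒙) ⊑ φ 𝒙
  φ-idem X (cX , Ys , _ , ys , disj , eq) with φ-flatten Ys ys disj
  ... | Zs , zs , disj′ , eq′ = φ-⋃ cX Zs (≐-trans eq eq′) zs disj′

  𝒞∖-anti : 𝒙 ⊑ 𝒚 → 𝒞∖ 𝒚 ⊑ 𝒞∖ 𝒙
  𝒞∖-anti s X (cX , ¬y) = cX , λ x → ¬y (s X x)

  φ̌-mono : 𝒙 ⊑ 𝒚 → φ̌ 𝒙 ⊑ φ̌ 𝒚
  φ̌-mono s = 𝒞∖-anti (φ-mono (𝒞∖-anti s))

  φ̌-≐ : X ≐ Y → φ̌ 𝒙 X → φ̌ 𝒙 Y
  φ̌-≐ eq (cX , n) = 𝒞-≐ eq cX , λ f → n (φ-≐ (≐-sym eq) f)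

  φ̌-⊑ : φ̌ 𝒙 ⊑ 𝒙
  φ̌-⊑ X (cX , n) = dne λ ¬x → n (φ-incl cX (cX , ¬x))

  -- Equivalent to `𝒖 ⊑ φ̌ 𝒖`: no member of `𝒖` can be partitioned into connected sets outside `𝒖`.
  IsOpen : Fam → Set₁
  IsOpen 𝒖 = (𝒖 ⊑ 𝒞) × (∀ X → 𝒖 X → ¬ φ (𝒞∖ 𝒖) X)

  open⇒⊑φ̌ : IsOpen 𝒙 → 𝒙 ⊑ 𝒚 → 𝒙 ⊑ φ̌ 𝒚
  open⇒⊑φ̌ (c , o) s X x = c X x , λ f → o X x (φ-mono (𝒞∖-anti s) X f)

  -- Connected sets outside `φ̌ 𝒙` lie in `φ (𝒞∖ 𝒙)`, and `φ` is idempotent.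
  φ̌-open : IsOpen (φ̌ 𝒙)
  φ̌-open {𝒙} = (λ _ → proj₁) , λ X (_ , n) f → n (φ-idem X (φ-mono dn X f))
    where
    dn : 𝒞∖ (φ̌ 𝒙) ⊑ φ (𝒞∖ 𝒙)
    dn Y (cY , ¬o) = dne λ ¬f → ¬o (cY , ¬f)

  -- An open `𝒙` lies in the interior of `φ 𝒙`, which gives one inclusion after applying `φ`; the
  -- other follows from `φ̌-⊑` and idempotence.
  φ-open⇒regClosed : IsOpen 𝒙 → IsRegClosed (φ 𝒙)
  φ-open⇒regClosed {𝒙} op@(c , _) = (λ _ → proj₁) ,
    φ-mono (open⇒⊑φ̌ op (λ X x → φ-incl (c X x) x)) ,
    λ X f → φ-idem X (φ-mono φ̌-⊑ X f)

  regClosed-≋ : a ≋ b → IsRegClosed b → IsRegClosed a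
  regClosed-≋ (s , t) (c , p , q) = (λ X x → c X (s X x)) ,
    (λ X x → φ-mono (φ̌-mono t) X (p X (s X x))) , λ X f → t X (q X (φ-mono (φ̌-mono s) X f))

  regClosed⇒closed : IsRegClosed a → φ a ⊑ a
  regClosed⇒closed (_ , p , q) X f = q X (φ-idem X (φ-mono p X f))

  regClosed-≐ : IsRegClosed a → X ≐ Y → a X → a Y
  regClosed-≐ (_ , p , q) eq x = q _ (φ-≐ eq (p _ x))

  -- `X` and the components of its complement partition `H`. With `𝒙` the complement of an open
  -- family, this contradicts that `H` is in that family.
  φ-components : 𝒞 H → X ⊆ H → Components (H ∖ X) Cs → 𝒙 X → All 𝒙 Cs → φ 𝒙 H
  φ-components {H} {X} {Cs} cH X⊆H (qs , disj , cover) x xs =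
    φ-⋃ cH (X ∷ Cs) (to , from) (x ∷ xs) (All.tabulate (λ i p c → proj₂ (component-⊆ (All.lookup qs i) c) p) ∷ disj)
    where
    to : H ⊆ ⋃ (X ∷ Cs)
    to {z} h with decide (X z)
    ... | yes p = inj₁ p
    ... | no ¬p = inj₂ (cover (h , ¬p))

    from : ⋃ (X ∷ Cs) ⊆ H
    from (inj₁ p) = X⊆H p
    from (inj₂ m) with ⋃⁻ Cs m
    ... | C , i , c = proj₁ (component-⊆ (All.lookup qs i) c)

  ∪-∖ : X ⊆ H → H ≐ X ∪ (H ∖ X)
  ∪-∖ {X} X⊆H = to , λ { (inj₁ x) → X⊆H x ; (inj₂ (h , _)) → h }
    where
    to : _ ⊆ X ∪ (_ ∖ X)
    to {z} h with decide (X z)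
    ... | yes p = inj₁ p
    ... | no ¬p = inj₂ (h , ¬p)

  missing : ¬ (X ⊆ Y) → NonEmpty (X ∖ Y)
  missing {X} {Y} ¬s = dne λ none → ¬s λ {z} x → dne λ ¬y → none (z , x , ¬y)

  cut-complement : IsCut H X → ¬ (X ≐ H) → IsCut H (H ∖ X)
  cut-complement (_ , X⊆H , cX , cX′) X≢H =
    missing (λ s → X≢H (X⊆H , s)) , proj₁ , cX′ , connected-≐ (≐-sym (∖∖ X⊆H)) cX

  cut⇒𝒞 : IsCut H X → 𝒞 X
  cut⇒𝒞 (ne , _ , c , _) = lift (ne , c)

  -- From a pseudo-ultrafilter to a completely join-irreducible element.

  module PseudoUltrafilter (H : Sub) (H∈𝒞 : 𝒞 H) (μ : Fam)
                           (isPseudoUltrafilter : Defs.IsPseudoUltrafilter G H μ) where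
    open Defs.IsPseudoUltrafilter isPseudoUltrafilter

    private
      H-ne : NonEmpty H
      H-ne = proj₁ (lower H∈𝒞)

      H-conn : Connected H
      H-conn = proj₂ (lower H∈𝒞)

    open InConnected H H-conn

    ∈ₑ-≐ : X ≐ Y → X ∈ₑ μ → Y ∈ₑ μ
    ∈ₑ-≐ eq (Z , z , eq′) = Z , z , ≐-trans eq′ eq

    member-class : IsCutClass (_∈ₑ μ)
    member-class = record
      { resp  = ∈ₑ-≐
      ; join  = λ cX cY cXY d → join _ _ _ cX cY cXY (id , id) d
      ; compl = λ cX X≢H ¬X → dne λ ¬X′ → ¬X (proj₂ (compl _ cX X≢H) ¬X′)
      }

    nonmember-class : IsCutClass (λ X → ¬ (X ∈ₑ μ))
    nonmember-class = record
      { resp  = λ eq ¬X y → ¬X (∈ₑ-≐ (≐-sym eq) y)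
      ; join  = λ cX cY cXY d → meet _ _ _ cX cY cXY (id , id) d
      ; compl = λ cX X≢H ¬¬X → proj₁ (compl _ cX X≢H) (dne ¬¬X)
      }

    module In = Kernel (_∈ₑ μ) member-class
    module Out = Kernel (λ X → ¬ (X ∈ₑ μ)) nonmember-class

    -- Repetitions are removed from the list; it covers `H ∖ X` since the component of each vertex
    -- occurs in it up to `≐`.
    𝚓⇒Out : 𝚓 H μ X → Out.Kernel X
    𝚓⇒Out (ne , cX , X⊆H , Cs , qs , all , out) with components-disjoint Cs qs
    ... | Ds , ps , disj , sub = ne , cX , X⊆H , Ds , (ps , disj , cover) , All.map (λ {C} → out C) ps
      where
      cover : H ∖ _ ⊆ ⋃ Ds
      cover s = sub (find (all _ (componentAt s)) (Defs.here s))
        where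
        find : ∀ {Cs} → Any (C ≐_) Cs → C ⊆ ⋃ Cs
        find (Any.here (t , _)) c = inj₁ (t c)
        find (Any.there i)      c = inj₂ (find i c)

    Out⇒𝚓 : Out.Kernel X → 𝚓 H μ X
    Out⇒𝚓 {X} (ne , cX , X⊆H , Cs , comps , outs) = ne , cX , X⊆H , Cs , proj₁ comps ,
      (λ C → components-complete comps) , λ C q → out (components-complete comps q) outs
      where
      out : ∀ {Cs} → Any (C ≐_) Cs → All (λ D → ¬ (D ∈ₑ μ)) Cs → ¬ (C ∈ₑ μ)
      out (Any.here eq) (¬d ∷ _)  c = ¬d (∈ₑ-≐ eq c)
      out (Any.there i) (_ ∷ ¬ds) c = out i ¬ds c

    𝚓⊑𝒞 : 𝚓 H μ ⊑ 𝒞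
    𝚓⊑𝒞 X (ne , cX , _) = lift (ne , cX)

    module _ {P : Fam} (isCutClass : IsCutClass P) where
      open Kernel P isCutClass

      kernel-φ : 𝒙 ⊑ 𝒞 → Kernel X → φ 𝒙 X → Σ Sub λ Y → 𝒙 Y × Kernel Y × Y ⊆ X
      kernel-φ s k (_ , [] , ne , _) = ⊥-elim (ne refl)
      kernel-φ s k (_ , Y₁ ∷ Ys , _ , ys , disj , eq)
        with kernel-pieces _ Y₁ Ys refl k eq (All.map (λ {Y} y → lower (s Y y)) ys) disj
      ... | Y , i , kY = Y , All.lookup ys i , kY , λ y → proj₂ eq (⋃⁺ i y)

    H∈Kernel : ∀ {P} (isCutClass : IsCutClass P) → Kernel.Kernel P isCutClass H
    H∈Kernel _ = H-ne , H-conn , id , [] , ([] , [] , λ (h , ¬h) → ⊥-elim (¬h h)) , []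

    H∈𝚓 : 𝚓 H μ H
    H∈𝚓 = Out⇒𝚓 (H∈Kernel nonmember-class)

    𝚓-open : IsOpen (𝚓 H μ)
    𝚓-open = 𝚓⊑𝒞 , λ X x f → contra (kernel-φ nonmember-class (λ _ → proj₁) (𝚓⇒Out x) f)
      where
      contra : ¬ Σ Sub λ Y → 𝒞∖ (𝚓 H μ) Y × Out.Kernel Y × Y ⊆ X
      contra (Y , (_ , ¬y) , k , _) = ¬y (Out⇒𝚓 k)

    -- Some part `Y` of a partition of `X` into members of `𝚓 H μ` is again an `In` kernel. A
    -- component of `H ∖ Y` would be both in and outside `μ`, so there is none and `Y` is all of
    -- `H`.
    In∩φ𝚓 : In.Kernel X → φ (𝚓 H μ) X → H ⊆ X
    In∩φ𝚓 k f {h} hh with kernel-φ member-class 𝚓⊑𝒞 k f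
    ... | Y , (_ , _ , _ , _ , _ , _ , outs) , (_ , _ , _ , Cs , (qs , _ , cover) , ins) , Y⊆X =
      Y⊆X (dne λ ¬y → contra (⋃⁻ Cs (cover (hh , ¬y))))
      where
      contra : ¬ Σ Sub λ C → C ∈ Cs × C h
      contra (C , i , _) = outs C (All.lookup qs i) (All.lookup ins i)

    -- If `X` were not in `μ`, then `H ∖ X`, the only component left, would be; `X` would be an `In`
    -- kernel and so equal to `H`, against `top`.
    cut∈φ𝚓 : IsCut H X → φ (𝚓 H μ) X → X ∈ₑ μ
    cut∈φ𝚓 {X} cut@(ne , X⊆H , cX , cX′) f = dne absurd
      where
      absurd : ¬ ¬ (X ∈ₑ μ)
      absurd ¬X = X≢H (X⊆H , In∩φ𝚓 (ne , cX , X⊆H , [ H ∖ X ] ,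
        (closed⇒component (proj₁ (cut-complement cut X≢H)) cX′ id (λ _ _ s → s) ∷ [] , [] ∷ [] , inj₁) ,
        IsCutClass.compl member-class cut X≢H ¬X ∷ []) f)
        where
        X≢H : ¬ (X ≐ H)
        X≢H eq = ¬X (∈ₑ-≐ (≐-sym eq) top)

    φ𝚓-cji : ∀ {a} → a ≋ φ (𝚓 H μ) → IsRegClosed a × Defs.CompletelyJoinIrreducible G a
    φ𝚓-cji {a} (a⊑φ𝚓 , φ𝚓⊑a) =
      a-reg , a* , (a*-reg , a*⊏a , gap) , unique , below
      where
      a-reg : IsRegClosed a
      a-reg = regClosed-≋ (a⊑φ𝚓 , φ𝚓⊑a) (φ-open⇒regClosed 𝚓-open)

      aH : a H
      aH = φ𝚓⊑a H (φ-incl H∈𝒞 H∈𝚓)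

      a∖H : Fam
      a∖H X = a X × ¬ (X ≐ H)

      a* : Fam
      a* = φ (φ̌ a∖H)

      a*-reg : IsRegClosed a*
      a*-reg = φ-open⇒regClosed φ̌-open

      -- `H` is an `In` kernel with no components left over, so a partition of it into members of
      -- `a∖H` would have an `In` kernel among its parts, and that part would equal `H`.
      H∉a* : ¬ a* H
      H∉a* f with kernel-φ member-class (λ _ → proj₁) (H∈Kernel member-class) f
      ... | Y , o , k , Y⊆H with φ̌-⊑ Y o
      ...   | aY , Y≢H = Y≢H (Y⊆H , In∩φ𝚓 k (a⊑φ𝚓 Y aY))

      a*⊏a : a* ⊏ a
      a*⊏a = (λ X f → regClosed⇒closed a-reg X (φ-mono (λ Y o → proj₁ (φ̌-⊑ Y o)) X f)) , λ s → H∉a* (s H aH)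

      -- For `Y` in `𝚓 H μ`, the components of `H ∖ Y` are cuts outside `μ`, hence outside `a` and
      -- outside `φ̌ 𝒚`. Were `Y` outside `φ̌ 𝒚` too, `H` would be partitioned into sets outside
      -- this open family.
      H∈φ̌⇒a⊑ : IsRegClosed 𝒚 → 𝒚 ⊑ a → φ̌ 𝒚 H → a ⊑ 𝒚
      H∈φ̌⇒a⊑ {𝒚} (_ , _ , φφ̌⊑𝒚) 𝒚⊑a o X aX = φφ̌⊑𝒚 X (φ-mono 𝚓⊑φ̌𝒚 X (a⊑φ𝚓 X aX))
        where
        𝚓⊑φ̌𝒚 : 𝚓 H μ ⊑ φ̌ 𝒚
        𝚓⊑φ̌𝒚 Y jY = dne λ ¬o → absurd ¬o (𝚓⇒Out jY)
          where
          absurd : ¬ φ̌ 𝒚 Y → ¬ Out.Kernel Y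
          absurd ¬o (ne , cY , Y⊆H , Cs , comps@(qs , _ , _) , outs) =
            proj₂ φ̌-open H o (φ-components H∈𝒞 Y⊆H comps (𝚓⊑𝒞 Y jY , ¬o)
              (All.tabulate λ {C} i → outside (All.lookup qs i) (All.lookup outs i)))
            where
            outside : IsComponent (H ∖ Y) C → ¬ (C ∈ₑ μ) → 𝒞∖ (φ̌ 𝒚) C
            outside q@(neC , cC , _) ¬C = lift (neC , cC) , λ oC →
              ¬C (cut∈φ𝚓 (component-cut ne cY Y⊆H q) (a⊑φ𝚓 _ (𝒚⊑a _ (φ̌-⊑ _ oC))))

      below : ∀ y → IsRegClosed y → y ⊏ a → y ⊑ a*
      below y y-reg@(_ , y⊑φφ̌ , _) (y⊑a , a⋢y) X yX = φ-mono (open⇒⊑φ̌ φ̌-open φ̌y⊑) X (y⊑φφ̌ X yX)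
        where
        φ̌y⊑ : φ̌ y ⊑ a∖H
        φ̌y⊑ Y o = y⊑a Y (φ̌-⊑ Y o) , λ eq → a⋢y (H∈φ̌⇒a⊑ y-reg y⊑a (φ̌-≐ eq o))

      gap : ∀ z → IsRegClosed z → a* ⊏ z → ¬ (z ⊏ a)
      gap z z-reg (_ , z⋢a*) z⊏a = z⋢a* (below z z-reg z⊏a)

      unique : ∀ b → Defs.IsLowerCover G b a → b ≋ a*
      unique b (b-reg , b⊏a , b-gap) = b⊑a* , dne λ a*⋢b → b-gap a* a*-reg (b⊑a* , a*⋢b) a*⊏a
        where
        b⊑a* : b ⊑ a*
        b⊑a* = below b b-reg b⊏a

  -- If the interior of `a` lay in `b`, so would its closure, which is `a`.
  regClosed-escape : IsRegClosed a → IsRegClosed b → ¬ (a ⊑ b) → Σ Sub λ H → φ̌ a H × ¬ b H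
  regClosed-escape a-reg b-reg a⋢b = dne λ none → a⋢b λ X aX → regClosed⇒closed b-reg X
    (φ-mono (λ Y o → dne λ ¬bY → none (Y , o , ¬bY)) X (proj₁ (proj₂ a-reg) X aX))

  -- From a completely join-irreducible element to a pseudo-ultrafilter.

  module JoinIrreducible (a : Fam) (a-reg : IsRegClosed a) (a* : Fam) (a*-reg : IsRegClosed a*)
                         (below : ∀ y → IsRegClosed y → y ⊏ a → y ⊑ a*)
                         (H : Sub) (H∈φ̌a : φ̌ a H) (H∉a* : ¬ a* H) where

    a-closed : φ a ⊑ a
    a-closed = regClosed⇒closed a-reg

    H∈𝒞 : 𝒞 H
    H∈𝒞 = proj₁ H∈φ̌a

    ⊑a* : IsRegClosed 𝒚 → 𝒚 ⊑ a → ¬ 𝒚 H → 𝒚 ⊑ a*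
    ⊑a* y-reg y⊑a ¬yH = below _ y-reg (y⊑a , λ s → ¬yH (s H (φ̌-⊑ H H∈φ̌a)))

    proper⇒a* : ¬ (H ⊆ X) → a X → a* X
    proper⇒a* {X} H⊈X aX = ⊑a* (φ-open⇒regClosed v-open) φv⊑a ¬φvH X φvX
      where
      v : Fam
      v Y = φ̌ a Y × (Y ⊆ X)

      v-open : IsOpen v
      -- Parts of a set `Y ⊆ X` are themselves subsets of `X`, so a part outside `v` is outside
      -- `φ̌ a`, and openness of `φ̌ a` applies.
      v-open = (λ _ o → proj₁ (proj₁ o)) , λ Y (o , Y⊆X) (cY , Ys , ne , ys , disj , eq) →
        proj₂ φ̌-open Y o (cY , Ys , ne ,
          All.tabulate (λ i → let cZ , ¬v = All.lookup ys i in
            cZ , λ oZ → ¬v (oZ , λ z → Y⊆X (proj₂ eq (⋃⁺ i z)))) , disj , eq)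

      φv⊑a : φ v ⊑ a
      φv⊑a Y f = a-closed Y (φ-mono (λ Z (o , _) → φ̌-⊑ Z o) Y f)

      ¬φvH : ¬ φ v H
      ¬φvH (_ , Ys , _ , ys , _ , H⊆ , _) = H⊈X λ h → inX (⋃⁻ Ys (H⊆ h))
        where
        inX : (Σ Sub λ C → C ∈ Ys × C x) → X x
        inX (C , i , c) = proj₂ (All.lookup ys i) c

      φvX : φ v X
      φvX with proj₁ (proj₂ a-reg) X aX
      ... | cX , Ys , ne , ys , disj , eq =
        cX , Ys , ne , All.tabulate (λ i → All.lookup ys i , λ y → proj₂ eq (⋃⁺ i y)) , disj , eq

    μ : Fam
    μ X = a X × IsCut H X

    private
      μ⁺ : IsCut H X → a X → X ∈ₑ μ
      μ⁺ cut aX = _ , (aX , cut) , id , id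

      μ⁻ : X ∈ₑ μ → a X
      μ⁻ (Y , (aY , _) , eq) = regClosed-≐ a-reg eq aY

      ∉μ : IsCut H X → ¬ (X ∈ₑ μ) → 𝒞∖ a X
      ∉μ cut ¬X = cut⇒𝒞 cut , λ aX → ¬X (μ⁺ cut aX)

    not-both : IsCut H X → ¬ (X ≐ H) → a X → ¬ a (H ∖ X)
    not-both {X} ((x , p) , X⊆H , _) X≢H aX aX′ = H∉a* (regClosed⇒closed a*-reg H
      (φ-pair H∈𝒞 (∪-∖ X⊆H) (λ q (_ , ¬q) → ¬q q)
        (proper⇒a* (λ s → X≢H (X⊆H , s)) aX) (proper⇒a* (λ s → proj₂ (s (X⊆H p)) p) aX′)))

    -- Otherwise `X` and `H ∖ X` would partition `H` into sets outside `a`, although `H` is in the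
    -- interior of `a`.
    not-neither : IsCut H X → ¬ (X ≐ H) → ¬ a X → ¬ ¬ a (H ∖ X)
    not-neither {X} cut@(_ , X⊆H , _) X≢H ¬aX ¬aX′ = proj₂ H∈φ̌a
      (φ-pair H∈𝒞 (∪-∖ X⊆H) (λ q (_ , ¬q) → ¬q q) (cut⇒𝒞 cut , ¬aX)
        (cut⇒𝒞 (cut-complement cut X≢H) , ¬aX′))

    μ-isPseudoUltrafilter : Defs.IsPseudoUltrafilter G H μ
    μ-isPseudoUltrafilter = record
      { cuts  = λ _ → proj₂
      ; top   = μ⁺ (proj₁ (lower H∈𝒞) , id , proj₂ (lower H∈𝒞) , λ (h , ¬h) → ⊥-elim (¬h h)) (φ̌-⊑ H H∈φ̌a)
      ; join  = λ X Y Z _ _ cZ eq d x y →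
          μ⁺ cZ (a-closed Z (φ-pair (cut⇒𝒞 cZ) eq d (μ⁻ x) (μ⁻ y)))
      ; meet  = meet
      ; compl = λ X cut X≢H → (λ x x′ → not-both cut X≢H (μ⁻ x) (μ⁻ x′)) ,
          λ ¬X′ → μ⁺ cut (dne λ ¬aX → not-neither cut X≢H ¬aX λ aX′ → ¬X′ (μ⁺ (cut-complement cut X≢H) aX′))
      }
      where
      meet : ∀ X Y Z → IsCut H X → IsCut H Y → IsCut H Z → Z ≐ X ∪ Y → Disjoint X Y →
        ¬ (X ∈ₑ μ) → ¬ (Y ∈ₑ μ) → ¬ (Z ∈ₑ μ)
      meet X Y Z cX cY cZ@(_ , Z⊆H , _) eq d ¬X ¬Y z with decide (Z ≐ H)
      ... | yes Z≐H = proj₂ H∈φ̌a (φ-pair H∈𝒞 (≐-trans (≐-sym Z≐H) eq) d (∉μ cX ¬X) (∉μ cY ¬Y))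
      -- Since `Z` is in `a`, its complement is not; thus `X`, `Y` and `H ∖ Z` partition `H` into
      -- sets outside `a`.
      ... | no Z≢H = proj₂ H∈φ̌a (φ-idem H (φ-pair H∈𝒞 (∪-∖ Z⊆H) (λ q (_ , ¬q) → ¬q q)
        (φ-pair (cut⇒𝒞 cZ) eq d (∉μ cX ¬X) (∉μ cY ¬Y))
        (φ-incl cZ′ (cZ′ , not-both cZ Z≢H (μ⁻ z)))))
        where
        cZ′ : 𝒞 (H ∖ Z)
        cZ′ = cut⇒𝒞 (cut-complement cZ Z≢H)

    open PseudoUltrafilter H H∈𝒞 μ μ-isPseudoUltrafilter
    open InConnected H (proj₂ (lower H∈𝒞))

    -- A partition of `X` into sets outside `a` would extend, by the components of `H ∖ X`, to such
    -- a partition of `H`: these components are cuts outside `μ` and hence outside `a`.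
    𝚓⊑φ̌a : 𝚓 H μ ⊑ φ̌ a
    𝚓⊑φ̌a X jX = 𝚓⊑𝒞 X jX , absurd (𝚓⇒Out jX)
      where
      absurd : Out.Kernel X → ¬ φ (𝒞∖ a) X
      absurd (ne , cX , X⊆H , Cs , comps@(qs , _) , outs) f =
        proj₂ H∈φ̌a (φ-idem H (φ-components H∈𝒞 X⊆H comps f
          (All.tabulate λ i → outside (component-cut ne cX X⊆H (All.lookup qs i)) (All.lookup outs i))))
        where
        outside : IsCut H C → ¬ (C ∈ₑ μ) → φ (𝒞∖ a) C
        outside cut ¬C = φ-incl (proj₁ (∉μ cut ¬C)) (∉μ cut ¬C)

    a≋φ𝚓 : a ≋ φ (𝚓 H μ)
    a≋φ𝚓 = dne (λ a⋢φ𝚓 → H∉a* (below _ (φ-open⇒regClosed 𝚓-open) (φ𝚓⊑a , a⋢φ𝚓) H (φ-incl H∈𝒞 H∈𝚓))) , φ𝚓⊑a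
      where
      φ𝚓⊑a : φ (𝚓 H μ) ⊑ a
      φ𝚓⊑a X f = a-closed X (φ-mono (λ Y j → φ̌-⊑ Y (𝚓⊑φ̌a Y j)) X f)

open import Defs

theorem15p9 : ({ℓ : Level} → ExcludedMiddle ℓ) → (G : Graph) → (a : Fam G) →
    (IsRegClosed G a × CompletelyJoinIrreducible G a)
    ⇔ Σ (Sub G) (λ H → 𝒞 G H × Σ (Fam G) (λ μ →
    IsPseudoUltrafilter G H μ × _≋_ G a (φ G (𝚓 G H μ))))
theorem15p9 em G a = mk⇔ to from
  where
  open RegularClosedFamilies em G using (regClosed-escape; module JoinIrreducible; module PseudoUltrafilter)

  to : IsRegClosed G a × CompletelyJoinIrreducible G a → _
  to (a-reg , a* , (a*-reg , (_ , a⋢a*) , _) , _ , below) with regClosed-escape a-reg a*-reg a⋢a*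
  ... | H , H∈φ̌a , H∉a* = H , H∈𝒞 , μ , μ-isPseudoUltrafilter , a≋φ𝚓
    where open JoinIrreducible a a-reg a* a*-reg below H H∈φ̌a H∉a*

  from : _ → IsRegClosed G a × CompletelyJoinIrreducible G a
  from (H , H∈𝒞 , μ , pu , eq) = PseudoUltrafilter.φ𝚓-cji H H∈𝒞 μ pu eq
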